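{- Consider TOTATIVE. The nim-value of $n>1$ is the index of the smallest prime divisor of $n$, and $\mathcal{SG}(1)=0$.
   Context: TOTATIVE is the impartial normal-play game on the positive integers where from $n$ a player moves to a smaller relatively prime residue, i.e. to any $k$ with $1\le k<n$ and $\gcd(k,n)=1$; the player unable to move loses. $\mathcal{SG}$ (nim-value) denotes the Sprague-Grundy value (mex rule). Primes are indexed with $2$ having index $1$, $3$ index $2$, etc. -}

module Defs where

open import Data.List using (List; filter; upTo)
open import Data.List.Extrema.Nat using (max; xs≤max)
open import Data.List.Membership.DecPropositional using () renaming (_∈?_ to member?)
open import Data.List.Membership.Propositional using (_∈_; mapWith∈)
open import Data.List.Membership.Propositional.Properties using (∈-filter⁻; ∈-upTo⁻)
import Data.List.Relation.Unary.All as All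
open import Data.Nat using (ℕ; zero; suc; _+_; _≤_; _<_; s≤s)
open import Data.Nat.Divisibility using (_∣_)
open import Data.Nat.GCD using (gcd)
open import Data.Nat.Induction using (<-wellFounded)
open import Data.Nat.Primality using (Prime)
open import Data.Nat.Properties using (_≟_; _≤?_; _<?_; <-irrefl; m<1+n⇒m<n∨m≡n; +-suc; +-identityʳ)
open import Data.Product using (∃; _×_; _,_; proj₁; proj₂)
open import Data.Sum using (inj₁; inj₂)
open import Induction.WellFounded using (Acc; acc; WellFounded; module Subrelation)
open import Relation.Binary.PropositionalEquality using (_≡_; refl; sym; subst)
open import Relation.Nullary using (¬_; Dec; yes; no)
open import Relation.Nullary.Decidable using (_×-dec_)

IsMex : List ℕ → ℕ → Set
IsMex xs m = ¬ (m ∈ xs) × (∀ {j} → j < m → j ∈ xs)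

mexExists : ∀ xs → ∃ (IsMex xs)
mexExists xs = search (suc (max 0 xs)) 0
  (λ {x} x∈xs → subst (x <_) (sym (+-identityʳ _)) (s≤s (All.lookup (xs≤max 0 xs) x∈xs)))
  (λ ())
  where
  search : ∀ fuel m → (∀ {x} → x ∈ xs → x < fuel + m) → (∀ {j} → j < m → j ∈ xs) → ∃ (IsMex xs)
  search zero m bound below = m , (λ m∈xs → <-irrefl refl (bound m∈xs)) , below
  search (suc fuel) m bound below with member? _≟_ m xs
  ... | no  m∉xs = m , m∉xs , below
  ... | yes m∈xs = search fuel (suc m) (λ {x} x∈xs → subst (x <_) (sym (+-suc fuel m)) (bound x∈xs)) below′
    where
    below′ : ∀ {j} → j < suc m → j ∈ xs
    below′ j<1+m with m<1+n⇒m<n∨m≡n j<1+m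
    ... | inj₁ j<m  = below j<m
    ... | inj₂ refl = m∈xs

mex : List ℕ → ℕ
mex xs = proj₁ (mexExists xs)

-- Finitely many options at each position, and every play ends.
record ImpartialGame : Set₁ where
  field
    Position    : Set
    options     : Position → List Position
    terminating : WellFounded (λ q p → q ∈ options p)

module _ (G : ImpartialGame) where
  open ImpartialGame G

  sgAcc : ∀ p → Acc (λ q p → q ∈ options p) p → ℕ
  sgAcc p (acc rs) = mex (mapWith∈ (options p) (λ {q} q∈ → sgAcc q (rs q∈)))

  SG : Position → ℕ
  SG p = sgAcc p (terminating p)

TotativeMove : ℕ → ℕ → Set
TotativeMove n k = 1 ≤ k × k < n × gcd k n ≡ 1

totativeMove? : ∀ n k → Dec (TotativeMove n k)
totativeMove? n k = (1 ≤? k) ×-dec (k <? n) ×-dec (gcd k n ≟ 1)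

-- The positions of the game proper are the positive integers; 0 is an extra
-- position with no moves into or out of it, so it affects no other value.
totative : ImpartialGame
totative = record
  { Position    = ℕ
  ; options     = options
  ; terminating = Subrelation.wellFounded decreasing <-wellFounded
  }
  where
  options : ℕ → List ℕ
  options n = filter (totativeMove? n) (upTo n)

  decreasing : ∀ {k n} → k ∈ options n → k < n
  decreasing {k} {n} k∈ = ∈-upTo⁻ (proj₁ (∈-filter⁻ (totativeMove? n) {xs = upTo n} k∈))

-- PrimeIndex p i: p is the i-th prime in increasing order, counting from 1.
data PrimeIndex : ℕ → ℕ → Set where
  first : PrimeIndex 2 1
  next  : ∀ {p q i} → PrimeIndex p i → Prime q → p < q →
          (∀ {r} → p < r → r < q → ¬ Prime r) → PrimeIndex q (suc i)

record IsSmallestPrimeDivisor (p n : ℕ) : Set where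
  field
    prime    : Prime p
    divides  : p ∣ n
    smallest : ∀ {q} → Prime q → q ∣ n → p ≤ q

{-# OPTIONS --safe #-}

-- Let p be the smallest prime divisor of n > 1 and i its index; by induction,
-- i is the mex of the values of the options.  No option k has value i: 1 has
-- value 0 < i, and any other k of value i would be divisible by p, hence not
-- coprime to n.  Every j < i is attained: 0 by the move to 1, and j > 0 by the
-- move to the j-th prime, which is less than p and so does not divide n.

module Submission where

open import Defs
open import Data.List using (upTo)
open import Data.List.Membership.Propositional using (_∈_)
open import Data.List.Membership.Propositional.Properties using (∈-filter⁺; ∈-filter⁻; ∈-upTo⁺)
open import Data.List.Relation.Unary.Any.Properties using (mapWith∈⁺; mapWith∈⁻)
open import Data.Nat using (ℕ; zero; suc; 2+; _+_; _≤_; _<_; _>_; z<s; s≤s; s≤s⁻¹; NonTrivial; >-nonZero; nonTrivial⇒n>1)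
open import Data.Nat.Coprimality using (Coprime; coprime⇒gcd≡1; gcd≡1⇒coprime; 1-coprimeTo)
open import Data.Nat.Divisibility using (_∣_; _∤_; _∣?_; ∣-refl; ∣⇒≤; hasNonTrivialDivisor)
open import Data.Nat.Primality using (Prime; prime?; prime[2]; prime⇒irreducible; prime⇒nonTrivial; ¬prime[1]; _Rough_; 2-rough; ∤⇒rough-suc; rough∧∣⇒prime)
open import Data.Nat.Properties using (<-cmp; <-irrefl; <-trans; <-≤-trans; <⇒≤; <⇒≱; ≤-refl; ≮⇒≥; m<1+n⇒m<n∨m≡n; m≤n⇒m<n∨m≡n; m≤n⇒m≤1+n; m<n⇒n≢0; +-suc; m∸n+n≡m)
open import Data.Product using (∃; _×_; _,_; proj₂)
open import Data.Sum using (inj₁; inj₂)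
open import Induction.WellFounded using (Acc; acc)
open import Relation.Binary.Definitions using (tri<; tri≈; tri>)
open import Relation.Binary.PropositionalEquality using (_≡_; refl; sym; trans; subst)
open import Relation.Nullary using (¬_; yes; no; contradiction)

open ImpartialGame totative using (options)
open IsSmallestPrimeDivisor

IsMex-unique : ∀ {xs a b} → IsMex xs a → IsMex xs b → a ≡ b
IsMex-unique {a = a} {b} (a∉ , <a⇒∈) (b∉ , <b⇒∈) with <-cmp a b
... | tri< a<b _ _ = contradiction (<b⇒∈ a<b) a∉
... | tri≈ _ a≡b _ = a≡b
... | tri> _ _ b<a = contradiction (<a⇒∈ b<a) b∉

-- The search returns its own specification, so a mex can be identified by verifying `IsMex`,
-- without unfolding the search.
mex-unique : ∀ xs {m} → IsMex xs m → mex xs ≡ m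
mex-unique xs = IsMex-unique (proj₂ (mexExists xs))

PrimeIndex⇒Prime : ∀ {p i} → PrimeIndex p i → Prime p
PrimeIndex⇒Prime first           = prime[2]
PrimeIndex⇒Prime (next _ pr _ _) = pr

PrimeIndex⇒>0 : ∀ {p i} → PrimeIndex p i → 0 < i
PrimeIndex⇒>0 first          = z<s
PrimeIndex⇒>0 (next _ _ _ _) = z<s

-- By induction both primes follow the same predecessor; if they differed, the smaller would lie in
-- the prime-free gap below the larger.
PrimeIndex-uniqueˡ : ∀ {p q i} → PrimeIndex p i → PrimeIndex q i → p ≡ q
PrimeIndex-uniqueˡ first first = refl
-- In the mixed cases the predecessor `x` would have index 0.
PrimeIndex-uniqueˡ first (next x _ _ _) = contradiction (PrimeIndex⇒>0 x) λ ()
PrimeIndex-uniqueˡ (next x _ _ _) first = contradiction (PrimeIndex⇒>0 x) λ ()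
PrimeIndex-uniqueˡ {p} {q} (next x p-prime x<p gapₚ) (next y q-prime y<q gap_q)
  with refl ← PrimeIndex-uniqueˡ x y | <-cmp p q
... | tri< p<q _ _ = contradiction p-prime (gap_q x<p p<q)
... | tri≈ _ p≡q _ = p≡q
... | tri> _ _ q<p = contradiction q-prime (gapₚ y<q q<p)

-- A `PrimeIndex` proof contains the chain of all earlier primes; walking back along it reaches
-- index `j`. This supplies the prime options and also the uniqueness of indices.
smallerIndex : ∀ {p i j} → PrimeIndex p i → 0 < j → j < i → ∃ λ q → q < p × PrimeIndex q j
smallerIndex first 0<j j<1 = contradiction 0<j (<⇒≱ j<1)
smallerIndex (next x _ x<p _) 0<j j<1+i with m<1+n⇒m<n∨m≡n j<1+i
... | inj₂ refl = _ , x<p , x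
... | inj₁ j<i  with q , q<x , y ← smallerIndex x 0<j j<i = q , <-trans q<x x<p , y

-- Were one index smaller, the chain for the larger would hold a prime below `p` with that same
-- smaller index.
PrimeIndex-uniqueʳ : ∀ {p i j} → PrimeIndex p i → PrimeIndex p j → i ≡ j
PrimeIndex-uniqueʳ {p} {i} {j} x y with <-cmp i j
... | tri≈ _ i≡j _ = i≡j
... | tri< i<j _ _ with q , q<p , z ← smallerIndex y (PrimeIndex⇒>0 x) i<j =
  contradiction q<p (<-irrefl (PrimeIndex-uniqueˡ z x))
... | tri> _ _ j<i with q , q<p , z ← smallerIndex x (PrimeIndex⇒>0 y) j<i =
  contradiction q<p (<-irrefl (PrimeIndex-uniqueˡ z y))

-- Induction over all bounds, not only primes, carries along the gap condition that `next` demands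
-- when the bound reaches a new prime.
largestPrime≤ : ∀ n → ∃ λ p → ∃ (PrimeIndex p) × p ≤ 2+ n × (∀ {r} → p < r → r ≤ 2+ n → ¬ Prime r)
largestPrime≤ zero = 2 , (1 , first) , ≤-refl , λ 2<r r≤2 _ → <⇒≱ 2<r r≤2
largestPrime≤ (suc n) with p , (i , x) , p≤ , gap ← largestPrime≤ n | prime? (2+ (suc n))
... | yes pr = _ , (suc i , next x pr (s≤s p≤) λ p<r r<q → gap p<r (s≤s⁻¹ r<q))
             , ≤-refl , λ q<r r≤q _ → <⇒≱ q<r r≤q
... | no ¬pr = p , (i , x) , m≤n⇒m≤1+n p≤ , gap′
  where
  gap′ : ∀ {r} → p < r → r ≤ 2+ (suc n) → ¬ Prime r
  gap′ p<r r≤ with m≤n⇒m<n∨m≡n r≤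
  ... | inj₁ r<   = gap p<r (s≤s⁻¹ r<)
  ... | inj₂ refl = ¬pr

Prime⇒PrimeIndex : ∀ {p} → Prime p → ∃ (PrimeIndex p)
Prime⇒PrimeIndex {2+ n} pr with q , idx , q≤p , gap ← largestPrime≤ n | m≤n⇒m<n∨m≡n q≤p
... | inj₁ q<p  = contradiction pr (gap q<p ≤-refl)
... | inj₂ refl = idx

prime>1 : ∀ {p} → Prime p → 1 < p
prime>1 pr = nonTrivial⇒n>1 _ {{prime⇒nonTrivial pr}}

-- Roughness excludes nontrivial divisors of `n` below `m`: a proper factor of `m` would be one, and
-- so would a smaller prime divisor of `n`.
rough∧∣⇒smallestPrimeDivisor : ∀ {m n} .{{_ : NonTrivial m}} → m Rough n → m ∣ n → IsSmallestPrimeDivisor m n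
rough∧∣⇒smallestPrimeDivisor rough m∣n = record
  { prime    = rough∧∣⇒prime rough m∣n
  ; divides  = m∣n
  ; smallest = λ pr q∣n → ≮⇒≥ λ q<m →
      rough (hasNonTrivialDivisor {{prime⇒nonTrivial pr}} q<m q∣n)
  }

smallestPrimeDivisor : ∀ {n} → n > 1 → ∃ λ p → IsSmallestPrimeDivisor p n
smallestPrimeDivisor {n} n>1 = search _ 0 (m∸n+n≡m n>1) 2-rough
  where
  -- The candidate `2+ m` starts at 2 and `k` is its distance to `n`; at distance 0 the candidate is
  -- `n`, which divides itself.
  search : ∀ k m → k + 2+ m ≡ n → 2+ m Rough n → ∃ λ p → IsSmallestPrimeDivisor p n
  search zero m refl rough = n , rough∧∣⇒smallestPrimeDivisor rough ∣-refl
  search (suc k) m eq rough with 2+ m ∣? n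
  ... | yes m∣n = 2+ m , rough∧∣⇒smallestPrimeDivisor rough m∣n
  ... | no  m∤n = search k (suc m) (trans (+-suc k _) eq) (∤⇒rough-suc m∤n rough)

prime∧∣prime⇒≡ : ∀ {p q} → Prime p → Prime q → p ∣ q → p ≡ q
prime∧∣prime⇒≡ p-prime q-prime p∣q with prime⇒irreducible q-prime p∣q
... | inj₁ refl = contradiction p-prime ¬prime[1]
... | inj₂ p≡q  = p≡q

prime∧∤⇒coprime : ∀ {p n} → Prime p → p ∤ n → Coprime p n
prime∧∤⇒coprime pr p∤n (d∣p , d∣n) with prime⇒irreducible pr d∣p
... | inj₁ d≡1  = d≡1
... | inj₂ refl = contradiction d∣n p∤n

∈-options⁺ : ∀ {k n} → 1 ≤ k → k < n → Coprime k n → k ∈ options n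
∈-options⁺ {n = n} 1≤k k<n c =
  ∈-filter⁺ (totativeMove? n) (∈-upTo⁺ k<n) (1≤k , k<n , coprime⇒gcd≡1 c)

∈-options⁻ : ∀ {k n} → k ∈ options n → 1 ≤ k × Coprime k n
∈-options⁻ {n = n} k∈ with _ , 1≤k , _ , gcd≡1 ← ∈-filter⁻ (totativeMove? n) {xs = upTo n} k∈ =
  1≤k , gcd≡1⇒coprime gcd≡1

sgAcc-1 : ∀ a → sgAcc totative 1 a ≡ 0
sgAcc-1 (acc _) = refl

-- Quantifying over every accessibility proof `a` allows structural recursion on it: the induction
-- hypothesis applies directly to the proofs `rs k∈` inside `sgAcc`.
sgAcc->1 : ∀ {n} a → n > 1 → ∃ λ p → IsSmallestPrimeDivisor p n × PrimeIndex p (sgAcc totative n a)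
sgAcc->1 {n} (acc rs) n>1
  with p , spd ← smallestPrimeDivisor n>1
  with i , idx ← Prime⇒PrimeIndex (prime spd)
  = p , spd , subst (PrimeIndex p) (sym (mex-unique _ (i∉ , <i⇒∈))) idx
  where
  value : ∀ {k} → k ∈ options n → ℕ
  value {k} k∈ = sgAcc totative k (rs k∈)

  p≤n : p ≤ n
  p≤n = ∣⇒≤ {{>-nonZero (<⇒≤ n>1)}} (divides spd)

  value≢i : ∀ {k} (k∈ : k ∈ options n) → ¬ i ≡ value k∈
  value≢i k∈ i≡v with 1≤k , coprime ← ∈-options⁻ k∈ | m≤n⇒m<n∨m≡n 1≤k
  ... | inj₂ refl = contradiction (trans i≡v (sgAcc-1 (rs k∈))) (m<n⇒n≢0 (PrimeIndex⇒>0 idx))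
  ... | inj₁ 1<k
    with q , q-spd , q-idx ← sgAcc->1 (rs k∈) 1<k
    -- Equal indices identify `q` with `p`, so `p` divides both `k` and `n`, and coprimality forces
    -- it to be 1.
    with refl ← PrimeIndex-uniqueˡ idx (subst (PrimeIndex q) (sym i≡v) q-idx)
    = <-irrefl (sym (coprime (divides q-spd , divides spd))) (prime>1 (prime spd))

  i∉ : ¬ i ∈ _
  i∉ i∈ with _ , k∈ , i≡v ← mapWith∈⁻ (options n) value i∈ = value≢i k∈ i≡v

  <i⇒∈ : ∀ {j} → j < i → j ∈ _
  <i⇒∈ {zero} _ = mapWith∈⁺ value (1 , 1∈ , sym (sgAcc-1 (rs 1∈)))
    where
    1∈ : 1 ∈ options n
    1∈ = ∈-options⁺ ≤-refl n>1 (1-coprimeTo n)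
  <i⇒∈ {suc j} j<i with q , q<p , q-idx ← smallerIndex idx z<s j<i
    = mapWith∈⁺ value (q , q∈ , j≡v)
    where
    q-prime : Prime q
    q-prime = PrimeIndex⇒Prime q-idx

    q∈ : q ∈ options n
    q∈ = ∈-options⁺ (<⇒≤ (prime>1 q-prime)) (<-≤-trans q<p p≤n)
      (prime∧∤⇒coprime q-prime λ q∣n → <⇒≱ q<p (smallest spd q-prime q∣n))

    j≡v : suc j ≡ value q∈
    -- The smallest prime divisor of the prime `q` is `q` itself, so the induction hypothesis gives
    -- the option's value as an index of `q`.
    j≡v with r , r-spd , r-idx ← sgAcc->1 (rs q∈) (prime>1 q-prime)
      with refl ← prime∧∣prime⇒≡ (prime r-spd) q-prime (divides r-spd)
      = PrimeIndex-uniqueʳ q-idx r-idx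

mainTheorem6 : (∀ (n : ℕ) → n > 1 → ∃ λ p → IsSmallestPrimeDivisor p n × PrimeIndex p (SG totative n)) × SG totative 1 ≡ 0
mainTheorem6 = (λ n → sgAcc->1 (ImpartialGame.terminating totative n)) , sgAcc-1 (ImpartialGame.terminating totative 1)
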